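{- Let $\mathbf{X},\mathbf{Y}$ be quasivarieties and let $\langle\zeta,f\rangle:Tm(\mathcal{L}_{\mathbf{X}})\to Tm(\mathcal{L}_{\mathbf{Y}})$ be a sober translation. Then the assignment $\tau:\Xi(\mathbf{X})\to\Xi^f(\mathbf{Y})$, $\tau(\mathbf{K})=\{\mathcal{A}\in\mathbf{Y}:\theta(\mathcal{A})\in\mathbf{K}\}$, is a lattice isomorphism.
   Context: A quasivariety is a class of similar algebras closed under isomorphisms, subalgebras and reduced products. $\mathbf{X},\mathbf{Y}$ have languages $\mathcal{L}_{\mathbf{X}},\mathcal{L}_{\mathbf{Y}}$; $\Xi(\mathbf{K})$ is the lattice of subquasivarieties of $\mathbf{K}$. For a class $\mathbf{K}$, $\Phi\vDash_{\mathbf{K}}\lambda\approx\gamma$ means every assignment into an algebra of $\mathbf{K}$ satisfying $\Phi$ satisfies $\lambda\approx\gamma$. Selective translation: $\zeta$ assigns to each $n$-ary symbol $g\in\mathcal{L}_{\mathbf{X}}$ an $n$-ary term $\zeta(g)$ of $\mathcal{L}_{\mathbf{Y}}$; $f(x)$ is a unary term of $\mathcal{L}_{\mathbf{Y}}$ (the selector). For an infinite variable set $V$ define $\zeta_*:Tm(\mathcal{L}_{\mathbf{X}},V)\to Tm(\mathcal{L}_{\mathbf{Y}},V)$ by $\zeta_*(x)=f(x)$ on variables and $\zeta_*(g(\phi_1,\dots,\phi_n))=\zeta(g)(\zeta_*(\phi_1),\dots,\zeta_*(\phi_n))$ (in particular $\zeta_*(c)=\zeta(c)$ for constants), and $\zeta^*(\Phi)=\{\zeta_*(\delta)\approx\zeta_*(\gamma):\delta\approx\gamma\in\Phi\}$.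 $\langle\zeta,f\rangle$ is a selective translation if: (i) $\vDash_{\mathbf{Y}}f(f(x))\approx f(x)$; (ii) $\Phi\vDash_{\mathbf{X}}\lambda\approx\gamma$ implies $\zeta^*(\Phi)\cup\{f(x)\approx x:x\in V\}\vDash_{\mathbf{Y}}\zeta^*(\lambda\approx\gamma)$; (iii) for each $n$-ary $g\in\mathcal{L}_{\mathbf{X}}$, $\{f(x_i)\approx x_i:i\le n\}\vDash_{\mathbf{Y}}f(\zeta(g)(x_1,\dots,x_n))\approx\zeta(g)(x_1,\dots,x_n)$. For $\mathcal{A}\in\mathbf{Y}$, $\mathcal{A}^f=\{a\in A:f(a)=a\}$, and $\theta(\mathcal{A})\in\mathbf{X}$ is the algebra with universe $\mathcal{A}^f$ and operations $g^{\theta(\mathcal{A})}=\zeta(g)^{\mathcal{A}}$ restricted to $\mathcal{A}^f$. With restriction on homomorphisms, $\theta:\mathbf{Y}\to\mathbf{X}$ is a right adjoint functor; $\mathcal{F}:\mathbf{X}\to\mathbf{Y}$ is its left adjoint, with unit $\eta:1\Rightarrow\theta\mathcal{F}$ and counit $\varepsilon:\mathcal{F}\theta\Rightarrow1$. A selective translation is strongly selective if $\eta$ is an isomorphism, and sober if moreover $\varepsilon$ is pointwise injective and $\mathcal{F}$ preserves injective homomorphisms. For $\mathcal{A},\mathcal{B}\in\mathbf{Y}$, $\mathcal{B}\preceq_f\mathcal{A}$ means $\mathcal{B}$ is a subalgebra of $\mathcal{A}$ with $\mathcal{B}^f=\mathcal{A}^f$; for $\mathbf{K}\in\Xi(\mathbf{Y})$,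 $\mathbf{K}^\uparrow=\{\mathcal{A}\in\mathbf{Y}:\exists\mathcal{B}\in\mathbf{K},\ \mathcal{B}\preceq_f\mathcal{A}\}$; $\Xi^f(\mathbf{Y})=\{\mathbf{K}^\uparrow:\mathbf{K}\in\Xi(\mathbf{Y})\}$ is the complete lattice (under inclusion) of $\mathsf{PAt}$-$f$-quasivarieties. -}

module Defs where

open import Level using (Level; suc; _⊔_; Lift; lift; lower)
open import Algebra.Lattice.Bundles using (RawLattice)
import Algebra.Lattice.Bundles as Alg
open import Axiom.ExcludedMiddle using (ExcludedMiddle)
open import Axiom.DoubleNegationElimination using (em⇒dne)
open import Data.Empty using (⊥-elim)
open import Data.Fin.Base using (Fin; zero; toℕ)
open import Data.Fin.Properties using (toℕ-injective)
open import Data.List.Base using (List; []; _∷_; _++_; concat; tabulate; lookup; concatMap)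
open import Data.List.Membership.Propositional using () renaming (_∈_ to _∈ₗ_)
open import Data.List.Membership.Propositional.Properties
  using (∈-concat⁺′; ∈-tabulate⁺; ∈-++⁺ˡ; ∈-++⁺ʳ; ∈-++⁻; ∈-map⁺)
open import Data.List.Relation.Unary.Any using (here; there; index)
open import Data.List.Relation.Unary.Any.Properties using (lookup-index)
open import Data.Nat.Base using (ℕ)
open import Data.Product.Base using (Σ; Σ-syntax; ∃; _×_; _,_; proj₁; proj₂)
open import Data.Sum.Base using (inj₁; inj₂; [_,_]′)
open import Data.Unit.Polymorphic.Base using (⊤; tt)
open import Data.Vec.Functional using (Vector)
open import Function.Base using (_∘_; id; const)
open import Function.Bundles using (Func; _⇔_; mk⇔; Equivalence; _↣_; Injection)
open import Function.Definitions using (Injective; Bijective)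
open import Relation.Binary.Bundles using (Setoid)
open import Relation.Binary.Lattice.Bundles using (Lattice)
import Relation.Binary.Lattice.Properties.Lattice as LatticeProperties
open import Relation.Binary.PropositionalEquality as ≡ using (_≡_)
open import Relation.Nullary using (¬_; yes; no)
open import Relation.Unary using (Pred; _∈_; _⊆_; _≐_; _∩_; _∪_)
open import Relation.Unary.Polymorphic using (∅)

private
  variable
    ℓ : Level

-- Size convention: sets live in Set ℓ, and (proper) classes of algebras
-- are predicates valued in Set (suc ℓ).

record Signature (ℓ : Level) : Set (suc ℓ) where
  field
    Symbol : Set ℓ
    arity  : Symbol → ℕ

open Signature public

-- Universes are non-empty, as is usual in universal algebra.  The witness
-- `point` is not an operation: homomorphisms need not preserve it.

record Algebra (L : Signature ℓ) : Set (suc ℓ) where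
  field
    setoid  : Setoid ℓ ℓ
  open Setoid setoid public
  field
    point   : Carrier
    op      : (g : Symbol L) → Vector Carrier (arity L g) → Carrier
    op-cong : ∀ g {as bs} → (∀ i → as i ≈ bs i) → op g as ≈ op g bs

open Algebra public using (Carrier; setoid; point; op; op-cong)

record Hom {L : Signature ℓ} (A B : Algebra L) : Set ℓ where
  private
    module A = Algebra A
    module B = Algebra B
  field
    func : Func A.setoid B.setoid
  open Func func public using (to; cong)
  field
    homo : ∀ g as → to (A.op g as) B.≈ B.op g (to ∘ as)

open Hom public using (to; cong; homo)

IsInjective IsIso : {L : Signature ℓ} {A B : Algebra L} → Hom A B → Set ℓ
IsInjective {A = A} {B} h = Injective (Algebra._≈_ A) (Algebra._≈_ B) (to h)
IsIso       {A = A} {B} h = Bijective (Algebra._≈_ A) (Algebra._≈_ B) (to h)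

idHom : {L : Signature ℓ} (A : Algebra L) → Hom A A
idHom A = record
  { func = record { to = id ; cong = id }
  ; homo = λ _ _ → Algebra.refl A
  }

infixr 9 _∘ʰ_
_∘ʰ_ : {L : Signature ℓ} {A B C : Algebra L} → Hom B C → Hom A B → Hom A C
_∘ʰ_ {C = C} k h = record
  { func = record { to = to k ∘ to h ; cong = cong k ∘ cong h }
  ; homo = λ g as → Algebra.trans C (cong k (homo h g as)) (homo k g (to h ∘ as))
  }

infix 4 _≈ʰ_
_≈ʰ_ : {L : Signature ℓ} {A B : Algebra L} → Hom A B → Hom A B → Set ℓ
_≈ʰ_ {B = B} h k = ∀ a → Algebra._≈_ B (to h a) (to k a)

record Subuniverse {L : Signature ℓ} (A : Algebra L) : Set (suc ℓ) where
  open Algebra A using (_≈_)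
  field
    pred     : Pred (Carrier A) ℓ
    resp     : ∀ {a b} → a ≈ b → a ∈ pred → b ∈ pred
    closed   : ∀ g as → (∀ i → as i ∈ pred) → op A g as ∈ pred
    nonempty : ∃ pred

open Subuniverse public

subalgebra : {L : Signature ℓ} (A : Algebra L) → Subuniverse A → Algebra L
subalgebra A S = record
  { setoid  = record
    { Carrier       = ∃ (pred S)
    ; _≈_           = λ a b → proj₁ a ≈ proj₁ b
    ; isEquivalence = record { refl = refl ; sym = sym ; trans = trans }
    }
  ; point   = nonempty S
  ; op      = λ g as → op A g (proj₁ ∘ as) , closed S g (proj₁ ∘ as) (proj₂ ∘ as)
  ; op-cong = λ g → op-cong A g
  }
  where open Algebra A using (_≈_; refl; sym; trans)

-- Reduced products.  Neither properness of the filter nor non-emptiness of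
-- the index set is required, so trivial algebras are reduced products.

record Filter (I : Set ℓ) : Set (suc ℓ) where
  field
    sets     : Pred (Pred I ℓ) ℓ
    whole    : (λ _ → ⊤) ∈ sets
    ∩-closed : ∀ {P Q} → P ∈ sets → Q ∈ sets → P ∩ Q ∈ sets
    ⊆-closed : ∀ {P Q} → P ⊆ Q → P ∈ sets → Q ∈ sets

  everywhere : ∀ {P} → (∀ i → P i) → P ∈ sets
  everywhere p = ⊆-closed (λ {i} _ → p i) whole

  ⋂-closed : ∀ {n} (P : Vector (Pred I ℓ) n) → (∀ k → P k ∈ sets) → (λ i → ∀ k → P k i) ∈ sets
  ⋂-closed {ℕ.zero}  P p = everywhere (λ _ ())
  ⋂-closed {ℕ.suc n} P p =
    ⊆-closed (λ { (q , r) zero → q ; (q , r) (Fin.suc k) → r k })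
      (∩-closed (p zero) (⋂-closed (P ∘ Fin.suc) (p ∘ Fin.suc)))

reducedProduct : {L : Signature ℓ} (I : Set ℓ) → Filter I → (I → Algebra L) → Algebra L
reducedProduct I D A = record
  { setoid  = record
    { Carrier       = ∀ i → Carrier (A i)
    ; _≈_           = λ a b → (λ i → A.Eq i (a i) (b i)) ∈ sets
    ; isEquivalence = record
      { refl  = everywhere (λ i → A.refl i)
      ; sym   = ⊆-closed (λ {i} → A.sym i)
      ; trans = λ p q → ⊆-closed (λ { {i} (x , y) → A.trans i x y }) (∩-closed p q)
      }
    }
  ; point   = λ i → point (A i)
  ; op      = λ g as i → op (A i) g (λ k → as k i)
  ; op-cong = λ g eqs → ⊆-closed (λ {i} → op-cong (A i) g) (⋂-closed _ eqs)
  }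
  where
  open Filter D
  module A i = Algebra (A i) renaming (_≈_ to Eq)

Class : Signature ℓ → Set (suc (suc ℓ))
Class {ℓ} L = Pred (Algebra L) (suc ℓ)

record IsQuasivariety {L : Signature ℓ} (K : Class L) : Set (suc ℓ) where
  field
    closed-iso  : ∀ {A B} (h : Hom A B) → IsIso h → A ∈ K → B ∈ K
    closed-sub  : ∀ {A} (S : Subuniverse A) → A ∈ K → subalgebra A S ∈ K
    closed-prod : ∀ {I} (D : Filter I) {A : I → Algebra L} → (∀ i → A i ∈ K) → reducedProduct I D A ∈ K

record Quasivariety (L : Signature ℓ) : Set (suc (suc ℓ)) where
  field
    class          : Class L
    isQuasivariety : IsQuasivariety class
  open IsQuasivariety isQuasivariety public

open Quasivariety public

image : {L : Signature ℓ} {A B : Algebra L} → Hom A B → Subuniverse B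
image {A = A} {B} h = record
  { pred     = λ b → Σ[ a ∈ Carrier A ] to h a ≈ b
  ; resp     = λ { eq (a , p) → a , trans p eq }
  ; closed   = λ g bs ps → op A g (proj₁ ∘ ps) , trans (homo h g _) (op-cong B g (proj₂ ∘ ps))
  ; nonempty = to h (point A) , point A , refl
  }
  where open Algebra B using (_≈_; refl; trans)

inverse : {L : Signature ℓ} {A B : Algebra L} (h : Hom A B) → IsIso h → Hom B A
inverse {A = A} {B} h (inj , surj) = record
  { func = record
    { to   = from
    ; cong = λ eq → inj (trans (to-from _) (trans eq (sym (to-from _))))
    }
  ; homo = λ g bs → inj (trans (to-from _) (sym (trans (homo h g _) (op-cong B g (to-from ∘ bs)))))
  }
  where
  open Algebra B using (_≈_; trans; sym)
  from : Carrier B → Carrier A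
  from b = proj₁ (surj b)
  to-from : ∀ b → to h (from b) ≈ b
  to-from b = proj₂ (surj b) (Algebra.refl A)

inverse-injective : {L : Signature ℓ} {A B : Algebra L} (h : Hom A B) (iso : IsIso h) → IsInjective (inverse h iso)
inverse-injective {A = A} {B} h (inj , surj) eq =
  trans (sym (proj₂ (surj _) (Algebra.refl A))) (proj₂ (surj _) eq)
  where open Algebra B using (trans; sym)

fromImage : {L : Signature ℓ} {A B : Algebra L} (h : Hom B A) → IsInjective h → Hom (subalgebra A (image h)) B
fromImage {A = A} {B} h inj = record
  { func = record
    { to   = λ { (_ , b , _) → b }
    ; cong = λ {x} {y} eq → inj (trans (proj₂ (proj₂ x)) (trans eq (sym (proj₂ (proj₂ y)))))
    }
  ; homo = λ _ _ → Algebra.refl B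
  }
  where open Algebra A using (trans; sym)

fromImage-iso : {L : Signature ℓ} {A B : Algebra L} (h : Hom B A) (inj : IsInjective h) → IsIso (fromImage h inj)
fromImage-iso {A = A} h inj =
    (λ {x} {y} eq → trans (sym (proj₂ (proj₂ x))) (trans (cong h eq) (proj₂ (proj₂ y))))
  , λ b → (to h b , b , refl) , λ {z} eq → inj (trans (proj₂ (proj₂ z)) eq)
  where open Algebra A using (refl; trans; sym)

closed-emb : {L : Signature ℓ} (K : Quasivariety L) {A B : Algebra L} (h : Hom B A) →
             IsInjective h → A ∈ class K → B ∈ class K
closed-emb K h inj A∈K = closed-iso K (fromImage h inj) (fromImage-iso h inj) (closed-sub K (image h) A∈K)

closed-image : {L : Signature ℓ} (K : Quasivariety L) {A B : Algebra L} (h : Hom B A) →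
               IsInjective h → B ∈ class K → subalgebra A (image h) ∈ class K
closed-image K h inj = closed-emb K (fromImage h inj) (λ {x} {y} → proj₁ (fromImage-iso h inj) {x} {y})

data Generated {L : Signature ℓ} (C : Class L) : Class L where
  base : ∀ {A} → A ∈ C → A ∈ Generated C
  iso  : ∀ {A B} (h : Hom A B) → IsIso h → A ∈ Generated C → B ∈ Generated C
  sub  : ∀ {A} (S : Subuniverse A) → A ∈ Generated C → subalgebra A S ∈ Generated C
  prod : ∀ {I} (D : Filter I) {A : I → Algebra L} → (∀ i → A i ∈ Generated C) → reducedProduct I D A ∈ Generated C

generated : {L : Signature ℓ} → Class L → Quasivariety L
generated C = record
  { class          = Generated C
  ; isQuasivariety = record { closed-iso = iso ; closed-sub = sub ; closed-prod = prod }
  }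

generated-least : {L : Signature ℓ} {C : Class L} {K : Class L} → IsQuasivariety K → C ⊆ K → Generated C ⊆ K
generated-least K C⊆K (base p)     = C⊆K p
generated-least K C⊆K (iso h i p)  = IsQuasivariety.closed-iso K h i (generated-least K C⊆K p)
generated-least K C⊆K (sub S p)    = IsQuasivariety.closed-sub K S (generated-least K C⊆K p)
generated-least K C⊆K (prod D ps)  = IsQuasivariety.closed-prod K D (λ i → generated-least K C⊆K (ps i))

intersection : {L : Signature ℓ} → Quasivariety L → Quasivariety L → Quasivariety L
intersection K M = record
  { class          = class K ∩ class M
  ; isQuasivariety = record
    { closed-iso  = λ { h i (p , q) → closed-iso K h i p , closed-iso M h i q }
    ; closed-sub  = λ { S (p , q) → closed-sub K S p , closed-sub M S q }
    ; closed-prod = λ D ps → closed-prod K D (proj₁ ∘ ps) , closed-prod M D (proj₂ ∘ ps)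
    }
  }

Subquasivariety : {L : Signature ℓ} → Quasivariety L → Set (suc (suc ℓ))
Subquasivariety {L = L} X = Σ[ K ∈ Quasivariety L ] class K ⊆ class X

Ξ : {L : Signature ℓ} → Quasivariety L → Lattice (suc (suc ℓ)) (suc ℓ) (suc ℓ)
Ξ {L = L} X = record
  { Carrier   = Subquasivariety X
  ; _≈_       = λ K M → cl K ≐ cl M
  ; _≤_       = λ K M → cl K ⊆ cl M
  ; _∨_       = λ K M → generated (cl K ∪ cl M)
                      , generated-least (isQuasivariety X) λ { (inj₁ p) → proj₂ K p ; (inj₂ p) → proj₂ M p }
  ; _∧_       = λ K M → intersection (proj₁ K) (proj₁ M) , λ p → proj₂ K (proj₁ p)
  ; isLattice = record
    { isPartialOrder = record
      { isPreorder = record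
        { isEquivalence = record
          { refl  = id , id
          ; sym   = λ { (p , q) → q , p }
          ; trans = λ { (p , q) (r , s) → (λ x → r (p x)) , (λ x → q (s x)) }
          }
        ; reflexive = proj₁
        ; trans     = λ p q x → q (p x)
        }
      ; antisym = _,_
      }
    ; supremum = λ K M → (λ p → base (inj₁ p)) , (λ p → base (inj₂ p))
        , λ N p q → generated-least (isQuasivariety (proj₁ N)) λ { (inj₁ x) → p x ; (inj₂ x) → q x }
    ; infimum  = λ K M → proj₁ , proj₂ , λ N p q x → p x , q x
    }
  }
  where
  cl : Subquasivariety X → Class L
  cl K = class (proj₁ K)

data Term (L : Signature ℓ) {w : Level} (W : Set w) : Set (ℓ ⊔ w) where
  var  : W → Term L W
  node : (g : Symbol L) → Vector (Term L W) (arity L g) → Term L W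

eval : {L : Signature ℓ} {w : Level} {W : Set w} (A : Algebra L) → (W → Carrier A) → Term L W → Carrier A
eval A ρ (var x)     = ρ x
eval A ρ (node g ts) = op A g (λ i → eval A ρ (ts i))

infixl 8 _[_]
_[_] : {L : Signature ℓ} {w v : Level} {W : Set w} {V : Set v} → Term L W → (W → Term L V) → Term L V
var x     [ σ ] = σ x
node g ts [ σ ] = node g (λ i → (ts i) [ σ ])

Equation : {w : Level} → Signature ℓ → Set w → Set (ℓ ⊔ w)
Equation L W = Term L W × Term L W

infix 4 _,_⊨_ _⊨[_]_
_,_⊨_ : {L : Signature ℓ} {w : Level} {W : Set w} (A : Algebra L) → (W → Carrier A) → Equation L W → Set ℓ
A , ρ ⊨ (s , t) = Algebra._≈_ A (eval A ρ s) (eval A ρ t)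

_⊨[_]_ : {L : Signature ℓ} {w : Level} {W : Set w} → Pred (Equation L W) (ℓ ⊔ w) → Class L → Equation L W → Set (suc ℓ ⊔ w)
Φ ⊨[ K ] e = ∀ {A} → A ∈ K → ∀ ρ → (∀ {e′} → e′ ∈ Φ → A , ρ ⊨ e′) → A , ρ ⊨ e

module _ {L : Signature ℓ} {w : Level} {W : Set w} where

  eval-cong : (A : Algebra L) {ρ σ : W → Carrier A} → (∀ x → Algebra._≈_ A (ρ x) (σ x)) →
              ∀ t → Algebra._≈_ A (eval A ρ t) (eval A σ t)
  eval-cong A eq (var x)     = eq x
  eval-cong A eq (node g ts) = op-cong A g (λ i → eval-cong A eq (ts i))

  eval-hom : {A B : Algebra L} (h : Hom A B) (ρ : W → Carrier A) →
             ∀ t → Algebra._≈_ B (to h (eval A ρ t)) (eval B (to h ∘ ρ) t)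
  eval-hom {B = B} h ρ (var x)     = Algebra.refl B
  eval-hom {B = B} h ρ (node g ts) =
    Algebra.trans B (homo h g _) (op-cong B g (λ i → eval-hom h ρ (ts i)))

  eval-subst : {v : Level} {V : Set v} (A : Algebra L) (ρ : V → Carrier A) (σ : W → Term L V) →
               ∀ t → Algebra._≈_ A (eval A ρ (t [ σ ])) (eval A (eval A ρ ∘ σ) t)
  eval-subst A ρ σ (var x)     = Algebra.refl A
  eval-subst A ρ σ (node g ts) = op-cong A g (λ i → eval-subst A ρ σ (ts i))

  eval-prod : {I : Set ℓ} (D : Filter I) (A : I → Algebra L) (ρ : W → ∀ i → Carrier (A i)) →
              ∀ t i → Algebra._≈_ (A i) (eval (reducedProduct I D A) ρ t i) (eval (A i) (λ x → ρ x i) t)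
  eval-prod D A ρ (var x)     i = Algebra.refl (A i)
  eval-prod D A ρ (node g ts) i = op-cong (A i) g (λ k → eval-prod D A ρ (ts k) i)

infixl 8 _⟨_⟩
_⟨_⟩ : {L : Signature ℓ} {w : Level} {W : Set w} → Term L (Fin 1) → Term L W → Term L W
f ⟨ t ⟩ = f [ const t ]

eval₁ : {L : Signature ℓ} (A : Algebra L) → Term L (Fin 1) → Carrier A → Carrier A
eval₁ A f a = eval A (const a) f

Fixed : {L : Signature ℓ} → Term L (Fin 1) → (A : Algebra L) → Pred (Carrier A) ℓ
Fixed f A a = Algebra._≈_ A (eval₁ A f a) a

Obj : {L : Signature ℓ} → Quasivariety L → Set (suc ℓ)
Obj {L = L} X = Σ[ A ∈ Algebra L ] A ∈ class X

Mor : {L : Signature ℓ} (X : Quasivariety L) → Obj X → Obj X → Set ℓ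
Mor X A B = Hom (proj₁ A) (proj₁ B)

record Functor {L L′ : Signature ℓ} (X : Quasivariety L) (Y : Quasivariety L′) : Set (suc ℓ) where
  field
    F₀       : Obj X → Obj Y
    F₁       : ∀ {A B} → Mor X A B → Mor Y (F₀ A) (F₀ B)
    F₁-cong  : ∀ {A B} {h k : Mor X A B} → h ≈ʰ k → F₁ {A} {B} h ≈ʰ F₁ {A} {B} k
    identity : ∀ {A} → F₁ {A} {A} (idHom (proj₁ A)) ≈ʰ idHom (proj₁ (F₀ A))
    compose  : ∀ {A B C} (h : Mor X A B) (k : Mor X B C) →
               F₁ {A} {C} (k ∘ʰ h) ≈ʰ F₁ {B} {C} k ∘ʰ F₁ {A} {B} h

record _⊣_ {L L′ : Signature ℓ} {X : Quasivariety L} {Y : Quasivariety L′}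
           (F : Functor X Y) (G : Functor Y X) : Set (suc ℓ) where
  private
    module F = Functor F
    module G = Functor G
  field
    η         : ∀ A → Mor X A (G.F₀ (F.F₀ A))
    η-natural : ∀ {A B} (h : Mor X A B) →
                η B ∘ʰ h ≈ʰ G.F₁ {F.F₀ A} {F.F₀ B} (F.F₁ {A} {B} h) ∘ʰ η A
    ε         : ∀ B → Mor Y (F.F₀ (G.F₀ B)) B
    ε-natural : ∀ {A B} (h : Mor Y A B) →
                h ∘ʰ ε A ≈ʰ ε B ∘ʰ F.F₁ {G.F₀ A} {G.F₀ B} (G.F₁ {A} {B} h)
    zig       : ∀ A → ε (F.F₀ A) ∘ʰ F.F₁ {A} {G.F₀ (F.F₀ A)} (η A) ≈ʰ idHom (proj₁ (F.F₀ A))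
    zag       : ∀ B → G.F₁ {F.F₀ (G.F₀ B)} {B} (ε B) ∘ʰ η (G.F₀ B) ≈ʰ idHom (proj₁ (G.F₀ B))

module _ {L L′ : Signature ℓ} (ζ : (g : Symbol L) → Term L′ (Fin (arity L g))) (f : Term L′ (Fin 1)) {V : Set ℓ} where

  translate : Term L V → Term L′ V
  translate (var x)     = f ⟨ var x ⟩
  translate (node g ts) = ζ g [ (λ i → translate (ts i)) ]

  translateEq : Equation L V → Equation L′ V
  translateEq (s , t) = translate s , translate t

  translateSet : Pred (Equation L V) ℓ → Pred (Equation L′ V) ℓ
  translateSet Φ e = Σ[ d ∈ Equation L V ] d ∈ Φ × e ≡ translateEq d

-- {f(x) ≈ x : x ∈ W}
selects : {L : Signature ℓ} {w : Level} {W : Set w} → Term L (Fin 1) → Pred (Equation L W) (ℓ ⊔ w)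
selects f e = ∃ λ x → e ≡ (f ⟨ var x ⟩ , var x)

record SelectiveTranslation (V : Set ℓ) {L L′ : Signature ℓ} (X : Quasivariety L) (Y : Quasivariety L′) : Set (suc ℓ) where
  field
    ζ : (g : Symbol L) → Term L′ (Fin (arity L g))
    f : Term L′ (Fin 1)
    idempotent : ∅ ⊨[ class Y ] (f ⟨ f ⟨ var zero ⟩ ⟩ , f ⟨ var {W = Fin 1} zero ⟩)
    sound      : ∀ (Φ : Pred (Equation L V) ℓ) e → Φ ⊨[ class X ] e →
                 translateSet ζ f Φ ∪ selects f ⊨[ class Y ] translateEq ζ f e
    closed-ops : ∀ g → selects f ⊨[ class Y ] (f ⟨ ζ g ⟩ , ζ g)

  idempotent-at : ∀ {A} → A ∈ class Y → ∀ a → eval₁ A f a ∈ Fixed f A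
  idempotent-at {A} A∈Y a = begin
    eval₁ A f (eval₁ A f a)
      ≈⟨ eval-cong A (λ _ → eval-subst A (const a) (const (var zero)) f) f ⟨
    eval A (λ _ → eval A (const a) (f ⟨ x ⟩)) f
      ≈⟨ eval-subst A (const a) (const (f ⟨ x ⟩)) f ⟨
    eval A (const a) (f ⟨ f ⟨ x ⟩ ⟩)
      ≈⟨ idempotent A∈Y (const a) (λ ()) ⟩
    eval A (const a) (f ⟨ x ⟩)
      ≈⟨ eval-subst A (const a) (const x) f ⟩
    eval₁ A f a ∎
    where
    x : Term L′ (Fin 1)
    x = var zero
    open import Relation.Binary.Reasoning.Setoid (setoid A)

  selects-at : {w : Level} {W : Set w} (A : Algebra L′) (ρ : W → Carrier A) →
               (∀ x → ρ x ∈ Fixed f A) → ∀ {e} → e ∈ selects f → A , ρ ⊨ e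
  selects-at A ρ fixed (x , ≡.refl) =
    Algebra.trans A (eval-subst A ρ (const (var x)) f) (fixed x)

  closed-at : ∀ {A} → A ∈ class Y → ∀ g as → (∀ i → as i ∈ Fixed f A) → eval A as (ζ g) ∈ Fixed f A
  closed-at {A} A∈Y g as fixed =
    Algebra.trans A (Algebra.sym A (eval-subst A as (const (ζ g)) f))
      (closed-ops g A∈Y as (selects-at A as fixed))

module _ {V : Set ℓ} {L L′ : Signature ℓ} {X : Quasivariety L} {Y : Quasivariety L′}
         (T : SelectiveTranslation V X Y) where
  open SelectiveTranslation T

  θ : (A : Algebra L′) → A ∈ class Y → Algebra L
  θ A A∈Y = record
    { setoid  = record
      { Carrier       = ∃ (Fixed f A)
      ; _≈_           = λ a b → proj₁ a ≈ proj₁ b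
      ; isEquivalence = record { refl = refl ; sym = sym ; trans = trans }
      }
    ; point   = eval₁ A f (point A) , idempotent-at A∈Y (point A)
    ; op      = λ g as → eval A (proj₁ ∘ as) (ζ g) , closed-at A∈Y g (proj₁ ∘ as) (proj₂ ∘ as)
    ; op-cong = λ g eqs → eval-cong A eqs (ζ g)
    }
    where open Algebra A using (_≈_; refl; sym; trans)

  θ-hom : ∀ {A B} (A∈Y : A ∈ class Y) (B∈Y : B ∈ class Y) → Hom A B → Hom (θ A A∈Y) (θ B B∈Y)
  θ-hom {A} {B} A∈Y B∈Y h = record
    { func = record
      { to   = λ { (a , fa≈a) → to h a ,
                   Algebra.trans B (Algebra.sym B (eval-hom h (const a) f)) (cong h fa≈a) }
      ; cong = cong h
      }
    ; homo = λ g as → eval-hom h (proj₁ ∘ as) (ζ g)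
    }

  θ-MapsInto : Set (suc ℓ)
  θ-MapsInto = ∀ {A} (A∈Y : A ∈ class Y) → θ A A∈Y ∈ class X

  θ-functor : θ-MapsInto → Functor Y X
  θ-functor θ∈X = record
    { F₀       = λ { (A , A∈Y) → θ A A∈Y , θ∈X A∈Y }
    ; F₁       = λ { {_ , A∈Y} {_ , B∈Y} → θ-hom A∈Y B∈Y }
    ; F₁-cong  = λ eq a → eq (proj₁ a)
    ; identity = λ { {A , _} _ → Algebra.refl A }
    ; compose  = λ { {C = C , _} _ _ _ → Algebra.refl C }
    }

  -- θ∈X is part of the claim that θ is a functor Y → X; classically
  -- it is automatic, being derived from `sound` in θ-mapsInto by Mal'cev's
  -- axiomatisation of quasivarieties by implications (with excluded middle).

  record StronglySelective : Set (suc ℓ) where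
    field
      θ∈X   : θ-MapsInto
      F     : Functor X Y
      F⊣θ   : F ⊣ θ-functor θ∈X
    open Functor F public
    open _⊣_ F⊣θ public
    field
      η-iso : ∀ A → IsIso (η A)

  record Sober : Set (suc ℓ) where
    field
      stronglySelective : StronglySelective
    open StronglySelective stronglySelective public
    field
      ε-injective  : ∀ B → IsInjective (ε B)
      F₁-injective : ∀ {A B} (h : Mor X A B) → IsInjective h → IsInjective (F₁ {A} {B} h)

  -- Bᶠ = Aᶠ, for the subalgebra B of A on S
  SameFixed : (A : Algebra L′) → Subuniverse A → Set ℓ
  SameFixed A S = ∀ a → a ∈ Fixed f A ⇔
    (Σ[ b ∈ Carrier (subalgebra A S) ] b ∈ Fixed f (subalgebra A S) × Algebra._≈_ A (proj₁ b) a)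

  infix 9 _↑
  _↑ : Class L′ → Class L′
  (K ↑) A = A ∈ class Y × (Σ[ S ∈ Subuniverse A ] subalgebra A S ∈ K × SameFixed A S)

  inclusion : (A : Algebra L′) (S : Subuniverse A) → Hom (subalgebra A S) A
  inclusion A S = record
    { func = record { to = proj₁ ; cong = id }
    ; homo = λ _ _ → Algebra.refl A
    }

  sameFixed⇒⊆ : ∀ A S → SameFixed A S → Fixed f A ⊆ pred S
  sameFixed⇒⊆ A S same {a} fixed with Equivalence.to (same a) fixed
  ... | (_ , b∈S) , _ , b≈a = resp S b≈a b∈S

  ⊆⇒sameFixed : ∀ A S → Fixed f A ⊆ pred S → SameFixed A S
  ⊆⇒sameFixed A S Fix⊆S a = mk⇔
    (λ fixed → (a , Fix⊆S fixed) , trans (eval-hom (inclusion A S) _ f) fixed , refl)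
    (λ { (b , fixed , b≈a) →
      trans (eval-cong A (λ _ → sym b≈a) f)
        (trans (sym (eval-hom (inclusion A S) (const b) f)) (trans fixed b≈a)) })
    where open Algebra A using (refl; sym; trans)

  fixed-hom : ∀ {A B} (h : Hom A B) {a} → a ∈ Fixed f A → to h a ∈ Fixed f B
  fixed-hom {B = B} h {a} fixed = Algebra.trans B (Algebra.sym B (eval-hom h (const a) f)) (cong h fixed)

  ↑-mono : (K M : Class L′) → K ⊆ M → K ↑ ⊆ M ↑
  ↑-mono K M K⊆M (A∈Y , S , S∈K , same) = A∈Y , S , K⊆M S∈K , same

  ↑-extensive : (K : Subquasivariety Y) → class (proj₁ K) ⊆ class (proj₁ K) ↑
  ↑-extensive (K , K⊆Y) {A} A∈K =
    K⊆Y A∈K , total , closed-emb K (inclusion A total) id A∈K , ⊆⇒sameFixed A total (λ _ → tt)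
    where
    total : Subuniverse A
    total = record { pred = λ _ → ⊤ ; resp = λ _ → id ; closed = λ _ _ _ → tt ; nonempty = point A , tt }

  ∩-subuniverse : ∀ {A} → A ∈ class Y → (S S′ : Subuniverse A) → Fixed f A ⊆ pred S → Fixed f A ⊆ pred S′ → Subuniverse A
  ∩-subuniverse {A} A∈Y S S′ p q = record
    { pred     = pred S ∩ pred S′
    ; resp     = λ { eq (x , y) → resp S eq x , resp S′ eq y }
    ; closed   = λ g as ps → closed S g as (proj₁ ∘ ps) , closed S′ g as (proj₂ ∘ ps)
    ; nonempty = _ , p (idempotent-at A∈Y (point A)) , q (idempotent-at A∈Y (point A))
    }

  restrict : {A : Algebra L′} (S S′ : Subuniverse A) → pred S ⊆ pred S′ → Hom (subalgebra A S) (subalgebra A S′)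
  restrict {A} S S′ S⊆S′ = record
    { func = record { to = λ { (a , p) → a , S⊆S′ p } ; cong = id }
    ; homo = λ _ _ → Algebra.refl A
    }

  ↑-∩ : (K M : Quasivariety L′) → class K ↑ ∩ class M ↑ ⊆ (class K ∩ class M) ↑
  ↑-∩ K M {A} ((A∈Y , S , S∈K , same) , (_ , S′ , S′∈M , same′)) =
    A∈Y , S∩S′
        , ( closed-emb K (restrict S∩S′ S proj₁) id S∈K
          , closed-emb M (restrict S∩S′ S′ proj₂) id S′∈M)
        , ⊆⇒sameFixed A S∩S′ (λ x → p x , q x)
    where
    p    = sameFixed⇒⊆ A S same
    q    = sameFixed⇒⊆ A S′ same′
    S∩S′ = ∩-subuniverse A∈Y S S′ p q

  ↑-closed-emb : (K : Quasivariety L′) → ∀ {A B} (h : Hom B A) → IsInjective h → A ∈ class K ↑ → B ∈ class K ↑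
  ↑-closed-emb K {A} {B} h inj (A∈Y , S , S∈K , same) =
    B∈Y , S′ , closed-emb K h′ inj S∈K , ⊆⇒sameFixed B S′ (λ fixed → Fix⊆S (fixed-hom h fixed))
    where
    B∈Y : B ∈ class Y
    B∈Y = closed-emb Y h inj A∈Y
    Fix⊆S : Fixed f A ⊆ pred S
    Fix⊆S = sameFixed⇒⊆ A S same
    S′ : Subuniverse B
    S′ = record
      { pred     = λ b → to h b ∈ pred S
      ; resp     = λ eq → resp S (cong h eq)
      ; closed   = λ g bs ps → resp S (Algebra.sym A (homo h g bs)) (closed S g _ ps)
      ; nonempty = eval₁ B f (point B) , Fix⊆S (fixed-hom h (idempotent-at B∈Y (point B)))
      }
    h′ : Hom (subalgebra B S′) (subalgebra A S)
    h′ = record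
      { func = record { to = λ { (b , p) → to h b , p } ; cong = cong h }
      ; homo = λ g bs → homo h g (proj₁ ∘ bs)
      }

  ↑-closed-prod : (K : Quasivariety L′) → ∀ {I} (D : Filter I) {A : I → Algebra L′} →
                  (∀ i → A i ∈ class K ↑) → reducedProduct I D A ∈ class K ↑
  ↑-closed-prod K {I} D {A} A∈K↑ =
    closed-prod Y D A∈Y , image h , closed-image K h (λ {x} {y} → h-inj {x} {y}) ΠS∈K
      , ⊆⇒sameFixed ΠA (image h) (λ {a} fixed →
          (λ i → eval₁ (A i) f (a i) , sameFixed⇒⊆ (A i) (S i) (proj₂ (proj₂ (proj₂ (A∈K↑ i)))) (idempotent-at (A∈Y i) (a i)))
          , Algebra.trans ΠA (everywhere (λ i → Algebra.sym (A i) (eval-prod D A (const a) f i))) fixed)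
    where
    open Filter D
    A∈Y : ∀ i → A i ∈ class Y
    A∈Y i = proj₁ (A∈K↑ i)
    S : ∀ i → Subuniverse (A i)
    S i = proj₁ (proj₂ (A∈K↑ i))
    ΠA ΠS : Algebra L′
    ΠA = reducedProduct I D A
    ΠS = reducedProduct I D (λ i → subalgebra (A i) (S i))
    h : Hom ΠS ΠA
    h = record
      { func = record { to = λ b i → proj₁ (b i) ; cong = id }
      ; homo = λ _ _ → Algebra.refl ΠA
      }
    ΠS∈K : ΠS ∈ class K
    ΠS∈K = closed-prod K D (λ i → proj₁ (proj₂ (proj₂ (A∈K↑ i))))
    h-inj : IsInjective h
    h-inj eq = eq

  ↑-isQuasivariety : (K : Quasivariety L′) → IsQuasivariety (class K ↑)
  ↑-isQuasivariety K = record
    { closed-iso  = λ h i → ↑-closed-emb K (inverse h i) (inverse-injective h i)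
    ; closed-sub  = λ {A} S → ↑-closed-emb K (inclusion A S) id
    ; closed-prod = ↑-closed-prod K
    }

  ↑-idempotent : (K : Quasivariety L′) → (class K ↑) ↑ ⊆ class K ↑
  ↑-idempotent K {A} (A∈Y , S , (_ , S′ , S′∈K , same′) , same) =
    A∈Y , image h , closed-image K h id S′∈K
        , ⊆⇒sameFixed A (image h) Fix⊆
    where
    B : Algebra L′
    B = subalgebra A S
    h : Hom (subalgebra B S′) A
    h = inclusion A S ∘ʰ inclusion B S′
    Fix⊆ : Fixed f A ⊆ pred (image h)
    Fix⊆ {a} fixed with Equivalence.to (same a) fixed
    ... | b , b-fixed , b≈a = (b , sameFixed⇒⊆ B S′ same′ b-fixed) , b≈a

  IsPAt-f-Quasivariety : Class L′ → Set (suc (suc ℓ))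
  IsPAt-f-Quasivariety C = Σ[ K ∈ Subquasivariety Y ] C ≐ class (proj₁ K) ↑

  Ξᶠ : Lattice (suc (suc ℓ)) (suc ℓ) (suc ℓ)
  Ξᶠ = record
    { Carrier   = ∃ IsPAt-f-Quasivariety
    ; _≈_       = λ C D → proj₁ C ≐ proj₁ D
    ; _≤_       = λ C D → proj₁ C ⊆ proj₁ D
    ; _∨_       = λ { (C , K , _) (D , M , _) → class (proj₁ (K Ξ.∨ M)) ↑ , (K Ξ.∨ M) , id , id }
    ; _∧_       = λ { (C , K , C≐K↑) (D , M , D≐M↑) → C ∩ D , (K Ξ.∧ M) , meet K M C≐K↑ D≐M↑ }
    ; isLattice = record
      { isPartialOrder = record
        { isPreorder = record
          { isEquivalence = record
            { refl  = id , id
            ; sym   = λ { (p , q) → q , p }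
            ; trans = λ { (p , q) (r , s) → (λ x → r (p x)) , (λ x → q (s x)) }
            }
          ; reflexive = proj₁
          ; trans     = λ p q x → q (p x)
          }
        ; antisym = _,_
        }
      ; supremum = λ { (C , K , C≐K↑) (D , M , D≐M↑) →
            (λ x → ↑-mono (cl K) (cl (K Ξ.∨ M)) (Ξ.x≤x∨y K M) (proj₁ C≐K↑ x))
          , (λ x → ↑-mono (cl M) (cl (K Ξ.∨ M)) (Ξ.y≤x∨y K M) (proj₁ D≐M↑ x))
          , λ { (E , N , E≐N↑) C≤E D≤E x → proj₂ E≐N↑ (least K M N
                  (λ y → proj₁ E≐N↑ (C≤E (proj₂ C≐K↑ y)))
                  (λ y → proj₁ E≐N↑ (D≤E (proj₂ D≐M↑ y))) x) } }
      ; infimum  = λ C D → proj₁ , proj₂ , λ E p q x → p x , q x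
      }
    }
    where
    module Ξ = Lattice (Ξ Y)
    cl : Subquasivariety Y → Class L′
    cl K = class (proj₁ K)
    meet : ∀ K M {C D} → C ≐ cl K ↑ → D ≐ cl M ↑ → C ∩ D ≐ cl (K Ξ.∧ M) ↑
    meet K M (C⊆ , ⊆C) (D⊆ , ⊆D) =
        (λ { (p , q) → ↑-∩ (proj₁ K) (proj₁ M) (C⊆ p , D⊆ q) })
      , λ x → ⊆C (↑-mono (cl (K Ξ.∧ M)) (cl K) proj₁ x) , ⊆D (↑-mono (cl (K Ξ.∧ M)) (cl M) proj₂ x)
    least : ∀ K M N → cl K ↑ ⊆ cl N ↑ → cl M ↑ ⊆ cl N ↑ → cl (K Ξ.∨ M) ↑ ⊆ cl N ↑
    least K M N K↑⊆N↑ M↑⊆N↑ x = ↑-idempotent (proj₁ N) (↑-mono (cl (K Ξ.∨ M)) (cl N ↑)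
      (generated-least (↑-isQuasivariety (proj₁ N))
        λ { (inj₁ y) → K↑⊆N↑ (↑-extensive K y) ; (inj₂ y) → M↑⊆N↑ (↑-extensive M y) }) x)

  τ : Class L → Class L′
  τ K A = Σ[ A∈Y ∈ A ∈ class Y ] θ A A∈Y ∈ K

raw : {c ℓ₁ ℓ₂ : Level} → Lattice c ℓ₁ ℓ₂ → RawLattice c ℓ₁
raw 𝓛 = Alg.Lattice.rawLattice (LatticeProperties.algLattice 𝓛)

Infinite : Set ℓ → Set ℓ
Infinite V = ℕ ↣ V

rename : {L : Signature ℓ} {W V : Set ℓ} → (W → V) → Equation L W → Equation L V
rename r (s , t) = s [ var ∘ r ] , t [ var ∘ r ]

module _ {L : Signature ℓ} {W : Set ℓ} where

  vars : Term L W → List W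
  vars (var x)     = x ∷ []
  vars (node g ts) = concat (tabulate (λ i → vars (ts i)))

  varsEq : Equation L W → List W
  varsEq (s , t) = vars s ++ vars t

  eval-local : (A : Algebra L) {ρ σ : W → Carrier A} → ∀ t →
               (∀ x → x ∈ₗ vars t → Algebra._≈_ A (ρ x) (σ x)) → Algebra._≈_ A (eval A ρ t) (eval A σ t)
  eval-local A (var x)     eq = eq x (here ≡.refl)
  eval-local A (node g ts) eq = op-cong A g λ i → eval-local A (ts i)
    λ x x∈ → eq x (∈-concat⁺′ x∈ (∈-tabulate⁺ i))

  ⊨-local : (A : Algebra L) {ρ σ : W → Carrier A} → ∀ e →
            (∀ x → x ∈ₗ varsEq e → Algebra._≈_ A (ρ x) (σ x)) → A , ρ ⊨ e → A , σ ⊨ e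
  ⊨-local A (s , t) eq p =
    trans (sym (eval-local A s (λ x x∈ → eq x (∈-++⁺ˡ x∈))))
      (trans p (eval-local A t (λ x x∈ → eq x (∈-++⁺ʳ (vars s) x∈))))
    where open Algebra A using (sym; trans)

  ⊨-rename⁺ : {V : Set ℓ} (A : Algebra L) (ρ : V → Carrier A) (r : W → V) →
              ∀ e → A , ρ ∘ r ⊨ e → A , ρ ⊨ rename r e
  ⊨-rename⁺ A ρ r (s , t) p =
    trans (eval-subst A ρ (var ∘ r) s) (trans p (sym (eval-subst A ρ (var ∘ r) t)))
    where open Algebra A using (sym; trans)

  ⊨-rename⁻ : {V : Set ℓ} (A : Algebra L) (ρ : V → Carrier A) (r : W → V) →
              ∀ e → A , ρ ⊨ rename r e → A , ρ ∘ r ⊨ e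
  ⊨-rename⁻ A ρ r (s , t) p =
    trans (sym (eval-subst A ρ (var ∘ r) s)) (trans p (eval-subst A ρ (var ∘ r) t))
    where open Algebra A using (sym; trans)

lower-em : ExcludedMiddle (suc ℓ) → ExcludedMiddle ℓ
lower-em {ℓ} em {P} with em {Lift (suc ℓ) P}
... | yes (lift p) = yes p
... | no ¬p        = no (λ p → ¬p (lift p))

-- Mal'cev: an algebra satisfying the implications of X embeds into a
-- product of reduced products of members of X.

module Mal'cev (em : ExcludedMiddle (suc ℓ)) {V : Set ℓ} (infinite : Infinite V) {L : Signature ℓ} (X : Quasivariety L)
               (C : Algebra L) (implications : ∀ (Φ : Pred (Equation L V) ℓ) e → Φ ⊨[ class X ] e →
                                 ∀ ρ → (∀ {e′} → e′ ∈ Φ → C , ρ ⊨ e′) → C , ρ ⊨ e) where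

  private
    module C = Algebra C

    em₀ : ExcludedMiddle ℓ
    em₀ = lower-em em

    Eqn : Set ℓ
    Eqn = Equation L C.Carrier

    Positive : Set ℓ
    Positive = Σ[ Φ ∈ List Eqn ] (∀ {e} → e ∈ₗ Φ → C , id ⊨ e)

    Negative : Set ℓ
    Negative = Σ[ e ∈ Eqn ] ¬ (C , id ⊨ e)

    Separates : Eqn → List Eqn → Set (suc ℓ)
    Separates e Φ = Σ[ B ∈ Algebra L ] B ∈ class X ×
      (Σ[ h ∈ (C.Carrier → Carrier B) ] (∀ {e′} → e′ ∈ₗ Φ → B , h ⊨ e′) × ¬ (B , h ⊨ e))

    module Renaming (ws : List C.Carrier) where

      position : C.Carrier → ℕ
      position c with em₀ {c ∈ₗ ws}
      ... | yes c∈ws = toℕ (index c∈ws)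
      ... | no _     = 0

      position-injective : ∀ {c d} → c ∈ₗ ws → d ∈ₗ ws → position c ≡ position d → c ≡ d
      position-injective {c} {d} c∈ d∈ eq with em₀ {c ∈ₗ ws} | em₀ {d ∈ₗ ws}
      ... | no c∉  | _      = ⊥-elim (c∉ c∈)
      ... | yes _  | no d∉  = ⊥-elim (d∉ d∈)
      ... | yes p  | yes q  =
        ≡.trans (lookup-index p) (≡.trans (≡.cong (lookup ws) (toℕ-injective eq)) (≡.sym (lookup-index q)))

      r : C.Carrier → V
      r c = Injection.to infinite (position c)

      s : V → C.Carrier
      s v with em₀ {Σ[ c ∈ C.Carrier ] c ∈ₗ ws × r c ≡ v}
      ... | yes (c , _) = c
      ... | no _        = C.point

      s-r : ∀ c → c ∈ₗ ws → s (r c) ≡ c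
      s-r c c∈ with em₀ {Σ[ d ∈ C.Carrier ] d ∈ₗ ws × r d ≡ r c}
      ... | yes (d , d∈ , eq) = position-injective d∈ c∈ (Injection.injective infinite eq)
      ... | no ¬p             = ⊥-elim (¬p (c , c∈ , ≡.refl))

    separate : ((e , _) : Negative) ((Φ , _) : Positive) → Separates e Φ
    separate (e , C⊭e) (Φ , C⊨Φ) = em⇒dne em λ ¬sep → C⊭e (conclude ¬sep)
      where
      ws : List C.Carrier
      ws = varsEq e ++ concatMap varsEq Φ
      open Renaming ws
      Φ′ : Pred (Equation L V) ℓ
      Φ′ e″ = Σ[ e′ ∈ Eqn ] e′ ∈ₗ Φ × e″ ≡ rename r e′
      s-r≈ : ∀ c → c ∈ₗ ws → c C.≈ s (r c)
      s-r≈ c c∈ = C.reflexive (≡.sym (s-r c c∈))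
      conclude : ¬ Separates e Φ → C , id ⊨ e
      conclude ¬sep = ⊨-local C e (λ c c∈ → C.sym (s-r≈ c (∈-++⁺ˡ c∈)))
        (⊨-rename⁻ C s r e (implications Φ′ (rename r e) valid s
          λ { (e′ , e′∈Φ , ≡.refl) → ⊨-rename⁺ C s r e′ (⊨-local C e′
            (λ c c∈ → s-r≈ c (∈-++⁺ʳ (varsEq e) (∈-concat⁺′ c∈ (∈-map⁺ varsEq e′∈Φ)))) (C⊨Φ e′∈Φ)) }))
        where
        valid : Φ′ ⊨[ class X ] rename r e
        valid {B} B∈X ρ B⊨Φ′ = ⊨-rename⁺ B ρ r e (em⇒dne em₀ λ B⊭e →
          ¬sep (B , B∈X , ρ ∘ r , (λ {e′} e′∈Φ → ⊨-rename⁻ B ρ r e′ (B⊨Φ′ (_ , e′∈Φ , ≡.refl))) , B⊭e))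

    eventually : Filter Positive
    eventually = record
      { sets     = λ P → Σ[ (Φ , _) ∈ Positive ] (∀ Ψ → (∀ {e} → e ∈ₗ Φ → e ∈ₗ proj₁ Ψ) → P Ψ)
      ; whole    = ([] , λ ()) , λ _ _ → tt
      ; ∩-closed = λ { ((Φ , Φ⁺) , p) ((Ψ , Ψ⁺) , q) →
          (Φ ++ Ψ , λ e∈ → [ Φ⁺ , Ψ⁺ ]′ (∈-++⁻ Φ e∈))
          , λ Θ incl → p Θ (incl ∘ ∈-++⁺ˡ) , q Θ (incl ∘ ∈-++⁺ʳ Φ) }
      ; ⊆-closed = λ { P⊆Q (Φ , p) → Φ , λ Ψ incl → P⊆Q (p Ψ incl) }
      }

    always : {I : Set ℓ} → Filter I
    always = record
      { sets     = λ P → ∀ i → P i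
      ; whole    = λ _ → tt
      ; ∩-closed = λ p q i → p i , q i
      ; ⊆-closed = λ P⊆Q p i → P⊆Q (p i)
      }

    factor : Negative → Positive → Algebra L
    factor e Φ = proj₁ (separate e Φ)

    value : ∀ e Φ → C.Carrier → Carrier (factor e Φ)
    value e Φ = proj₁ (proj₂ (proj₂ (separate e Φ)))

    satisfies : ∀ e Φ {e′} → e′ ∈ₗ proj₁ Φ → factor e Φ , value e Φ ⊨ e′
    satisfies e Φ = proj₁ (proj₂ (proj₂ (proj₂ (separate e Φ))))

    refutes : ∀ e Φ → ¬ (factor e Φ , value e Φ ⊨ proj₁ e)
    refutes e Φ = proj₂ (proj₂ (proj₂ (proj₂ (separate e Φ))))

    Π : Algebra L
    Π = reducedProduct Negative always λ e → reducedProduct Positive eventually (factor e)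

    Π∈X : Π ∈ class X
    Π∈X = closed-prod X always λ e → closed-prod X eventually λ Φ → proj₁ (proj₂ (separate e Φ))

    eventually-satisfies : ∀ e e′ → C , id ⊨ e′ → (λ Φ → factor e Φ , value e Φ ⊨ e′) ∈ Filter.sets eventually
    eventually-satisfies e e′ p =
      (e′ ∷ [] , λ { (here ≡.refl) → p }) , λ Ψ incl → satisfies e Ψ (incl (here ≡.refl))

    embedding : Hom C Π
    embedding = record
      { func = record
        { to   = λ c e Φ → value e Φ c
        ; cong = λ {c} {d} eq e → eventually-satisfies e (var c , var d) eq
        }
      ; homo = λ g cs e → eventually-satisfies e (var (op C g cs) , node g (var ∘ cs)) C.refl
      }

    embedding-injective : IsInjective embedding
    embedding-injective {c} {d} eq = em⇒dne em₀ λ c≉d →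
      let (Φ , p) = eq ((var c , var d) , c≉d)
      in refutes ((var c , var d) , c≉d) Φ (p Φ id)

  C∈X : C ∈ class X
  C∈X = closed-emb X embedding (λ {x} {y} → embedding-injective {x} {y}) Π∈X

module _ {V : Set ℓ} {L L′ : Signature ℓ} {X : Quasivariety L} {Y : Quasivariety L′}
         (T : SelectiveTranslation V X Y) where
  open SelectiveTranslation T

  eval-translate : ∀ {A} (A∈Y : A ∈ class Y) (ρ : V → Carrier (θ T A A∈Y)) → ∀ t →
    Algebra._≈_ A (eval A (proj₁ ∘ ρ) (translate ζ f t)) (proj₁ (eval (θ T A A∈Y) ρ t))
  eval-translate {A} A∈Y ρ (var x)     =
    Algebra.trans A (eval-subst A (proj₁ ∘ ρ) (const (var x)) f) (proj₂ (ρ x))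
  eval-translate {A} A∈Y ρ (node g ts) =
    Algebra.trans A (eval-subst A (proj₁ ∘ ρ) (λ i → translate ζ f (ts i)) (ζ g))
      (eval-cong A (λ i → eval-translate A∈Y ρ (ts i)) (ζ g))

  θ-mapsInto : ExcludedMiddle (suc ℓ) → Infinite V → θ-MapsInto T
  θ-mapsInto em infinite {A} A∈Y = Mal'cev.C∈X em infinite X (θ T A A∈Y) λ Φ e Φ⊨e ρ C⊨Φ →
    ⊨-translate⁻ ρ e (sound Φ e Φ⊨e A∈Y (proj₁ ∘ ρ)
      λ { (inj₁ (d , d∈Φ , ≡.refl)) → ⊨-translate⁺ ρ d (C⊨Φ d∈Φ)
        ; (inj₂ sel) → selects-at A (proj₁ ∘ ρ) (proj₂ ∘ ρ) sel })
    where
    open Algebra A using (sym; trans)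
    ⊨-translate⁺ : ∀ ρ e → θ T A A∈Y , ρ ⊨ e → A , proj₁ ∘ ρ ⊨ translateEq ζ f e
    ⊨-translate⁺ ρ (s , t) p = trans (eval-translate A∈Y ρ s) (trans p (sym (eval-translate A∈Y ρ t)))
    ⊨-translate⁻ : ∀ ρ e → A , proj₁ ∘ ρ ⊨ translateEq ζ f e → θ T A A∈Y , ρ ⊨ e
    ⊨-translate⁻ ρ (s , t) p = trans (sym (eval-translate A∈Y ρ s)) (trans p (eval-translate A∈Y ρ t))

{-# OPTIONS --safe #-}
module Submission where

-- The map τ is an order isomorphism, and an order isomorphism between lattices
-- preserves joins and meets.
--
-- The fixed points of f in a reduced product are, up to the filter, the
-- families of fixed points; hence θ commutes with reduced products, and it
-- clearly preserves embeddings.  So τ K is a quasivariety.  A subalgebra of A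
-- with the same fixed points as A has, up to isomorphism, the same image under
-- θ, so τ K is closed under ↑ and thus equals (τ K)↑.
--
-- Order is reflected because η identifies B with θ (F B): if τ K ⊆ τ M and
-- B ∈ K, then F B ∈ τ K ⊆ τ M, so B ≅ θ (F B) ∈ M.
--
-- For surjectivity, N↑ is τ K for K = {B : F B ∈ N↑}.  The class K is closed
-- under embeddings because F preserves them.  For products, Π Bᵢ ≅ Π θ (F Bᵢ)
-- ≅ θ (Π F Bᵢ), so F (Π Bᵢ) embeds into F (θ (Π F Bᵢ)), which ε embeds into
-- Π F Bᵢ ∈ N↑.  Finally A ∈ N↑ if and only if F (θ A) ∈ N↑: the counit embeds
-- F (θ A) into A, and by the triangle identity its image contains every fixed
-- point of A, so the image is a subalgebra with the same fixed points as A.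

open import Defs
open import Level using (Level)
open import Algebra.Lattice.Morphism.Structures using (module LatticeMorphisms)
open import Data.Product using (Σ-syntax; _,_; proj₁; proj₂)
open import Function.Base using (id; _∘_)
open import Relation.Binary.Lattice.Bundles using (Lattice)
open import Relation.Unary using (_∈_; _⊆_)

private
  variable
    ℓ : Level

module _ {a b ℓ₁ ℓ₂ ℓ₃ ℓ₄ : Level} (P : Lattice a ℓ₁ ℓ₂) (Q : Lattice b ℓ₃ ℓ₄) where
  private
    module P = Lattice P
    module Q = Lattice Q

  orderIso⇒latticeIso : (h : P.Carrier → Q.Carrier) →
    (∀ {x y} → x P.≤ y → h x Q.≤ h y) →
    (∀ {x y} → h x Q.≤ h y → x P.≤ y) →
    (∀ q → Σ[ x ∈ P.Carrier ] h x Q.≈ q) →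
    LatticeMorphisms.IsLatticeIsomorphism (raw P) (raw Q) h
  orderIso⇒latticeIso h mono reflects onto = record
    { isLatticeMonomorphism = record
      { isLatticeHomomorphism = record
        { isRelHomomorphism = record { cong = cong-h }
        ; ∧-homo = λ x y → Q.antisym
            (Q.∧-greatest (mono (P.x∧y≤x x y)) (mono (P.x∧y≤y x y)))
            (meet≤ x y)
        ; ∨-homo = λ x y → Q.antisym
            (≤join x y)
            (Q.∨-least (mono (P.x≤x∨y x y)) (mono (P.y≤x∨y x y)))
        }
      ; injective = λ eq → P.antisym (reflects (Q.reflexive eq))
                                     (reflects (Q.reflexive (Q.Eq.sym eq)))
      }
    ; surjective = λ q → proj₁ (onto q) , λ eq → Q.Eq.trans (cong-h eq) (proj₂ (onto q))
    }
    where
    cong-h : ∀ {x y} → x P.≈ y → h x Q.≈ h y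
    cong-h eq = Q.antisym (mono (P.reflexive eq)) (mono (P.reflexive (P.Eq.sym eq)))

    meet≤ : ∀ x y → (h x Q.∧ h y) Q.≤ h (x P.∧ y)
    meet≤ x y with onto (h x Q.∧ h y)
    ... | z , hz≈ = Q.trans (Q.reflexive (Q.Eq.sym hz≈)) (mono (P.∧-greatest
      (reflects (Q.trans (Q.reflexive hz≈) (Q.x∧y≤x (h x) (h y))))
      (reflects (Q.trans (Q.reflexive hz≈) (Q.x∧y≤y (h x) (h y))))))

    ≤join : ∀ x y → h (x P.∨ y) Q.≤ (h x Q.∨ h y)
    ≤join x y with onto (h x Q.∨ h y)
    ... | z , hz≈ = Q.trans (mono (P.∨-least
      (reflects (Q.trans (Q.x≤x∨y (h x) (h y)) (Q.reflexive (Q.Eq.sym hz≈))))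
      (reflects (Q.trans (Q.y≤x∨y (h x) (h y)) (Q.reflexive (Q.Eq.sym hz≈))))))
      (Q.reflexive hz≈)

embeddings∧products⇒isQuasivariety : {L : Signature ℓ} {K : Class L} →
  (∀ {A B} (h : Hom B A) → IsInjective h → A ∈ K → B ∈ K) →
  (∀ {I} (D : Filter I) {A : I → Algebra L} → (∀ i → A i ∈ K) → reducedProduct I D A ∈ K) →
  IsQuasivariety K
embeddings∧products⇒isQuasivariety emb product = record
  { closed-iso  = λ h i → emb (inverse h i) (inverse-injective h i)
  ; closed-sub  = λ {A} S → emb
      (record { func = record { to = proj₁ ; cong = id } ; homo = λ _ _ → Algebra.refl A }) id
  ; closed-prod = product
  }

module _ {L : Signature ℓ} {I : Set ℓ} (D : Filter I) {A B : I → Algebra L} (h : ∀ i → Hom (A i) (B i)) where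
  open Filter D

  productHom : Hom (reducedProduct I D A) (reducedProduct I D B)
  productHom = record
    { func = record { to = λ a i → to (h i) (a i) ; cong = ⊆-closed (λ {i} → cong (h i)) }
    ; homo = λ g as → everywhere (λ i → homo (h i) g (λ k → as k i))
    }

  productHom-injective : (∀ i → IsInjective (h i)) → IsInjective productHom
  productHom-injective inj = ⊆-closed (λ {i} → inj i)

module _ {V : Set ℓ} {L L′ : Signature ℓ} {X : Quasivariety L} {Y : Quasivariety L′}
         (T : SelectiveTranslation V X Y) where
  open SelectiveTranslation T

  -- Taking B = A and the identity shows that the choice of proof of A ∈ Y
  -- does not matter.
  θ-closed-emb : (K : Quasivariety L) → ∀ {A B} (A∈Y : A ∈ class Y) (B∈Y : B ∈ class Y)
                 (h : Hom B A) → IsInjective h → θ T A A∈Y ∈ class K → θ T B B∈Y ∈ class K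
  θ-closed-emb K A∈Y B∈Y h inj = closed-emb K (θ-hom T B∈Y A∈Y h) inj

  module _ {I : Set ℓ} (D : Filter I) {A : I → Algebra L′} (A∈Y : ∀ i → A i ∈ class Y)
           (ΠA∈Y : reducedProduct I D A ∈ class Y) where
    open Filter D
    private
      ΠA = reducedProduct I D A
      module ΠA = Algebra ΠA

    -- The canonical comparison Π θ(Aᵢ) → θ(Π Aᵢ).
    θ-product : Hom (reducedProduct I D (λ i → θ T (A i) (A∈Y i))) (θ T ΠA ΠA∈Y)
    θ-product = record
      { func = record
        { to   = λ b → (λ i → proj₁ (b i)) , everywhere (λ i → Algebra.trans (A i)
                   (eval-prod D A _ f i) (proj₂ (b i)))
        ; cong = id
        }
      ; homo = λ g bs → everywhere (λ i → Algebra.sym (A i) (eval-prod D A _ (ζ g) i))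
      }

    -- A fixed point of the reduced product is fixed only at almost every
    -- index; applying f at every index makes all coordinates fixed.
    θ-product-iso : IsIso θ-product
    θ-product-iso = id , λ { (a , fixed) →
      (λ i → eval₁ (A i) f (a i) , idempotent-at (A∈Y i) (a i))
      , λ {z} z≈fa → ΠA.trans {λ i → proj₁ (z i)} {λ i → eval₁ (A i) f (a i)} {a} z≈fa
          (ΠA.trans {λ i → eval₁ (A i) f (a i)} {eval₁ ΠA f a} {a}
            (everywhere (λ i → Algebra.sym (A i) (eval-prod D A _ f i))) fixed) }

  τ-isQuasivariety : (K : Quasivariety L) → IsQuasivariety (τ T (class K))
  τ-isQuasivariety K = embeddings∧products⇒isQuasivariety
    (λ { h inj (A∈Y , θA∈K) → let B∈Y = closed-emb Y h inj A∈Y in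
         B∈Y , θ-closed-emb K A∈Y B∈Y h inj θA∈K })
    (λ D As∈τK → let A∈Y = λ i → proj₁ (As∈τK i) ; ΠA∈Y = closed-prod Y D A∈Y in
         ΠA∈Y , closed-iso K (θ-product D A∈Y ΠA∈Y) (θ-product-iso D A∈Y ΠA∈Y)
                  (closed-prod K D (λ i → proj₂ (As∈τK i))))

  τ-subquasivariety : Quasivariety L → Subquasivariety Y
  τ-subquasivariety K = record { isQuasivariety = τ-isQuasivariety K } , proj₁

  -- If S contains every fixed point of A, then corestriction embeds θ A into
  -- the image under θ of the subalgebra on S.
  ↑-closed-τ : (K : Quasivariety L) → _↑ T (τ T (class K)) ⊆ τ T (class K)
  ↑-closed-τ K {A} (A∈Y , S , (S∈Y , θS∈K) , same) = A∈Y , closed-emb K corestriction id θS∈K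
    where
    open Algebra A using (trans; sym)
    B = subalgebra A S
    corestriction : Hom (θ T A A∈Y) (θ T B S∈Y)
    corestriction = record
      { func = record
        { to   = λ { (a , fixed) → (a , sameFixed⇒⊆ T A S same fixed) ,
                   trans (eval-hom (inclusion T A S) _ f) fixed }
        ; cong = id
        }
      ; homo = λ g as → sym (eval-hom (inclusion T A S) _ (ζ g))
      }

  τ-isPAt : (K : Subquasivariety X) → IsPAt-f-Quasivariety T (τ T (class (proj₁ K)))
  τ-isPAt (K , _) =
    τ-subquasivariety K , ↑-extensive T (τ-subquasivariety K) , ↑-closed-τ K

  τ-mono : (K M : Quasivariety L) → class K ⊆ class M → τ T (class K) ⊆ τ T (class M)
  τ-mono K M K⊆M (A∈Y , θA∈K) = A∈Y , K⊆M θA∈K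

  module _ (sober : Sober T) where
    open Sober sober

    τ-reflects-⊆ : (K M : Subquasivariety X) → τ T (class (proj₁ K)) ⊆ τ T (class (proj₁ M)) →
                   class (proj₁ K) ⊆ class (proj₁ M)
    τ-reflects-⊆ (K , K⊆X) (M , M⊆X) τK⊆τM {B} B∈K =
      let B′ = B , K⊆X B∈K
          (FB , FB∈Y) = F₀ B′
          (FB∈Y′ , θFB∈M) = τK⊆τM (FB∈Y , closed-iso K (η B′) (η-iso B′) B∈K)
      in closed-emb M (η B′) (λ {x} {y} → proj₁ (η-iso B′) {x} {y})
           (θ-closed-emb M FB∈Y′ FB∈Y (idHom FB) id θFB∈M)

    module _ (N : Quasivariety L′) where

      -- The class of those B in X with F B in N↑.
      F-preimage : Class L
      F-preimage B = Σ[ B∈X ∈ B ∈ class X ] proj₁ (F₀ (B , B∈X)) ∈ _↑ T (class N)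

      F-preimage-isQuasivariety : IsQuasivariety F-preimage
      F-preimage-isQuasivariety = embeddings∧products⇒isQuasivariety
        (λ { h inj (A∈X , FA∈N↑) → let B∈X = closed-emb X h inj A∈X in
             B∈X , ↑-closed-emb T N (F₁ {_ , B∈X} {_ , A∈X} h) (F₁-injective h inj) FA∈N↑ })
        product
        where
        product : ∀ {I} (D : Filter I) {B : I → Algebra L} →
                  (∀ i → B i ∈ F-preimage) → reducedProduct I D B ∈ F-preimage
        product {I} D {B} Bs =
          ΠB∈X , ↑-closed-emb T N (ε ΠFB ∘ʰ F₁ {ΠB} {θΠFB} h)
                   (λ eq → F₁-injective {ΠB} {θΠFB} h h-injective (ε-injective ΠFB eq))
                   (↑-closed-prod T N D (λ i → proj₂ (Bs i)))
          where
          FB : I → Obj Y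
          FB i = F₀ (B i , proj₁ (Bs i))
          ΠB∈X : reducedProduct I D B ∈ class X
          ΠB∈X = closed-prod X D (λ i → proj₁ (Bs i))
          ΠFB : Obj Y
          ΠFB = reducedProduct I D (proj₁ ∘ FB) , closed-prod Y D (proj₂ ∘ FB)
          ΠB θΠFB : Obj X
          ΠB   = _ , ΠB∈X
          θΠFB = θ T (proj₁ ΠFB) (proj₂ ΠFB) , θ∈X (proj₂ ΠFB)
          ηs : ∀ i → Hom (B i) (θ T (proj₁ (FB i)) (proj₂ (FB i)))
          ηs i = η (B i , proj₁ (Bs i))
          h : Hom (proj₁ ΠB) (proj₁ θΠFB)
          h = θ-product D (proj₂ ∘ FB) (proj₂ ΠFB) ∘ʰ productHom D ηs
          h-injective : IsInjective h
          h-injective {x} {y} = productHom-injective D ηs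
            (λ i {a} {b} → proj₁ (η-iso (B i , proj₁ (Bs i))) {a} {b}) {x} {y}

      F-preimage-subquasivariety : Subquasivariety X
      F-preimage-subquasivariety = record { isQuasivariety = F-preimage-isQuasivariety } , proj₁

      ↑⊆τ-F-preimage : _↑ T (class N) ⊆ τ T F-preimage
      ↑⊆τ-F-preimage {A} A∈N↑@(A∈Y , _) =
        A∈Y , θ∈X A∈Y , ↑-closed-emb T N (ε (A , A∈Y)) (ε-injective (A , A∈Y)) A∈N↑

      τ-F-preimage⊆↑ : τ T F-preimage ⊆ _↑ T (class N)
      τ-F-preimage⊆↑ {A} (A∈Y , θA∈X , FθA∈N↑) = ↑-idempotent T N
        ( A∈Y , image εA , closed-image N↑ εA (ε-injective (A , A∈Y)) FθA∈N↑′
        -- The triangle identity ε (η a) = a puts every fixed point a in the image.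
        , ⊆⇒sameFixed T A (image εA) (λ {a} fixed →
            proj₁ (to (η (θ T A A∈Y , θ∈X A∈Y)) (a , fixed)) , zag (A , A∈Y) (a , fixed)) )
        where
        N↑ : Quasivariety L′
        N↑ = record { isQuasivariety = ↑-isQuasivariety T N }
        εA : Hom (proj₁ (F₀ (θ T A A∈Y , θ∈X A∈Y))) A
        εA = ε (A , A∈Y)
        -- The given proof that θ A ∈ X may differ from the one used by the adjunction.
        FθA∈N↑′ : proj₁ (F₀ (θ T A A∈Y , θ∈X A∈Y)) ∈ class N↑
        FθA∈N↑′ = ↑-closed-emb T N
          (F₁ {θ T A A∈Y , θ∈X A∈Y} {θ T A A∈Y , θA∈X} (idHom (θ T A A∈Y)))
          (F₁-injective (idHom (θ T A A∈Y)) id) FθA∈N↑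

proposition6p14 : {ℓ : Level} {V : Set ℓ} → Infinite V →
    {L L′ : Signature ℓ} (X : Quasivariety L) (Y : Quasivariety L′)
    (T : SelectiveTranslation V X Y) → Sober T →
    Σ[ τ∈Ξᶠ ∈ ((K : Subquasivariety X) → IsPAt-f-Quasivariety T (τ T (class (proj₁ K)))) ]
    LatticeMorphisms.IsLatticeIsomorphism (raw (Ξ X)) (raw (Ξᶠ T))
    (λ K → τ T (class (proj₁ K)) , τ∈Ξᶠ K)
proposition6p14 _ X Y T sober =
  τ-isPAt T , orderIso⇒latticeIso (Ξ X) (Ξᶠ T) _
    (λ {K} {M} → τ-mono T (proj₁ K) (proj₁ M))
    (λ {K} {M} → τ-reflects-⊆ T sober K M)
    (λ { (C , (N , _) , C⊆N↑ , N↑⊆C) →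
         F-preimage-subquasivariety T sober N
         , (λ x → N↑⊆C (τ-F-preimage⊆↑ T sober N x))
         , (λ x → ↑⊆τ-F-preimage T sober N (C⊆N↑ x)) })
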